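{- Let $G$ be a finite perfect graph. For $v\in V(G)$ let $c(v)$ be the largest size of a clique of $G$ containing $v$, and let $i(v)$ be the largest size of an independent set of $G$ containing $v$. Then \[ \sum_{v\in V(G)}\frac{1}{c(v)\,i(v)}\le 1. \]
   Context: A graph $G$ is perfect if for every induced subgraph its chromatic number equals its clique number. -}

module Defs where

open import Data.Fin using (Fin; zero; suc; finToFun; funToFin)
open import Data.Fin.Properties
  using (_≟_; all?; any?; finToFun-funToFin; suc-injective)
open import Data.Fin.Subset
  using (Subset; inside; outside; ∣_∣; _∈_; ⁅_⁆; ⊥)
open import Data.Fin.Subset.Properties
  using (_∈?_; anySubset?; ∣p∣≤n; ∉⊥; x∈⁅x⁆; x∈⁅y⁆⇒x≡y; ∣⁅x⁆∣≡1)
open import Data.Nat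
  using (ℕ; zero; suc; _+_; _*_; _^_; _≤_; z≤n; NonZero; >-nonZero)
import Data.Nat.Properties as ℕ
open import Data.Product using (∃; _×_; _,_; proj₁; proj₂)
open import Data.Vec using (_∷_; here; there)
open import Function using (id)
open import Level using (0ℓ)
open import Relation.Binary using (Rel; Symmetric; Irreflexive)
  renaming (Decidable to Decidable₂)
open import Relation.Binary.PropositionalEquality
  using (_≡_; _≢_; refl; sym; trans; cong; subst)
open import Relation.Nullary using (¬_; yes; no; contradiction)
open import Relation.Nullary.Decidable using (map′; _→-dec_; _×-dec_; ¬?)
open import Relation.Unary using (Pred; Decidable)

private
  variable
    n : ℕ

-- Decidability of adjacency is automatic classically; constructively it is
-- what makes the clique, independence and chromatic numbers exist.
record Graph (n : ℕ) : Set₁ where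
  field
    Adj        : Rel (Fin n) 0ℓ
    adj?       : Decidable₂ Adj
    adj-sym    : Symmetric Adj
    adj-irrefl : Irreflexive _≡_ Adj

open Graph public

-- The increasing enumeration of the elements of S.
element : (S : Subset n) → Fin ∣ S ∣ → Fin n
element (inside  ∷ S) zero    = zero
element (inside  ∷ S) (suc i) = suc (element S i)
element (outside ∷ S) i       = suc (element S i)

element-injective : (S : Subset n) {i j : Fin ∣ S ∣} →
                    element S i ≡ element S j → i ≡ j
element-injective (inside  ∷ S) {zero}  {zero}  eq = refl
element-injective (inside  ∷ S) {suc i} {suc j} eq =
  cong suc (element-injective S (suc-injective eq))
element-injective (outside ∷ S) eq = element-injective S (suc-injective eq)

element-∈ : (S : Subset n) (i : Fin ∣ S ∣) → element S i ∈ S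
element-∈ (inside  ∷ S) zero    = here
element-∈ (inside  ∷ S) (suc i) = there (element-∈ S i)
element-∈ (outside ∷ S) i       = there (element-∈ S i)

element-surjective : (S : Subset n) {v : Fin n} → v ∈ S →
                     ∃ λ i → element S i ≡ v
element-surjective (inside  ∷ S) here = zero , refl
element-surjective (inside  ∷ S) (there v∈S) with element-surjective S v∈S
... | i , eq = suc i , cong suc eq
element-surjective (outside ∷ S) (there v∈S) with element-surjective S v∈S
... | i , eq = i , cong suc eq

-- G[S], with its vertices relabelled by Fin ∣ S ∣ in increasing order.
induced : Graph n → (S : Subset n) → Graph ∣ S ∣
induced G S = record
  { Adj        = λ i j → Adj G (element S i) (element S j)
  ; adj?       = λ i j → adj? G (element S i) (element S j)
  ; adj-sym    = adj-sym G
  ; adj-irrefl = λ i≡j → adj-irrefl G (cong (element S) i≡j)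
  }

IsClique : Graph n → Pred (Subset n) 0ℓ
IsClique G S = ∀ u v → u ∈ S → v ∈ S → u ≢ v → Adj G u v

IsIndependent : Graph n → Pred (Subset n) 0ℓ
IsIndependent G S = ∀ u v → u ∈ S → v ∈ S → ¬ Adj G u v

IsProperColouring : (G : Graph n) (k : ℕ) → Pred (Fin n → Fin k) 0ℓ
IsProperColouring G k f = ∀ u v → Adj G u v → f u ≢ f v

Colourable : Graph n → Pred ℕ 0ℓ
Colourable G k = ∃ (IsProperColouring G k)

IsLargestSize : Pred (Subset n) 0ℓ → Pred ℕ 0ℓ
IsLargestSize P k = (∃ λ S → P S × ∣ S ∣ ≡ k) × (∀ S → P S → ∣ S ∣ ≤ k)

IsLeast : Pred ℕ 0ℓ → Pred ℕ 0ℓ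
IsLeast P k = P k × (∀ m → P m → k ≤ m)

isClique? : (G : Graph n) → Decidable (IsClique G)
isClique? G S = all? λ u → all? λ v →
  (u ∈? S) →-dec ((v ∈? S) →-dec (¬? (u ≟ v) →-dec adj? G u v))

isIndependent? : (G : Graph n) → Decidable (IsIndependent G)
isIndependent? G S = all? λ u → all? λ v →
  (u ∈? S) →-dec ((v ∈? S) →-dec ¬? (adj? G u v))

isProperColouring? : (G : Graph n) (k : ℕ) → Decidable (IsProperColouring G k)
isProperColouring? G k f = all? λ u → all? λ v →
  adj? G u v →-dec ¬? (f u ≟ f v)

colourable? : (G : Graph n) → Decidable (Colourable G)
colourable? {n} G k = map′ to from
  (any? λ (i : Fin (k ^ n)) → isProperColouring? G k (finToFun i))
  where
  to : (∃ λ i → IsProperColouring G k (finToFun i)) → Colourable G k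
  to (i , p) = finToFun i , p

  from : Colourable G k → ∃ λ i → IsProperColouring G k (finToFun i)
  from (f , p) = funToFin f , λ u v uv eq → p u v uv
    (trans (sym (finToFun-funToFin f u)) (trans eq (finToFun-funToFin f v)))

colourable-n : (G : Graph n) → Colourable G n
colourable-n G = id , λ u v uv u≡v → adj-irrefl G u≡v uv

largestSize : {P : Pred (Subset n) 0ℓ} → Decidable P → ∃ P →
              ∃ (IsLargestSize P)
largestSize {n} {P} P? (S₀ , PS₀) = search n λ S _ → ∣p∣≤n S
  where
  search : ∀ b → (∀ S → P S → ∣ S ∣ ≤ b) → ∃ (IsLargestSize P)
  search b bound with anySubset? (λ S → P? S ×-dec (∣ S ∣ ℕ.≟ b))
  search b       bound | yes found = b , found , bound
  search zero    bound | no  none  =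
    contradiction (S₀ , PS₀ , ℕ.n≤0⇒n≡0 (bound S₀ PS₀)) none
  search (suc b) bound | no  none  = search b λ S PS →
    ℕ.≤-pred (ℕ.≤∧≢⇒< (bound S PS) (λ eq → none (S , PS , eq)))

least : {P : Pred ℕ 0ℓ} → Decidable P → ∃ P → ∃ (IsLeast P)
least {P} P? (b , Pb) = search b 0 (subst P (sym (ℕ.+-identityʳ b)) Pb)
                                   (λ _ _ → z≤n)
  where
  search : ∀ d k → P (d + k) → (∀ m → P m → k ≤ m) → ∃ (IsLeast P)
  search zero    k Pk below = k , Pk , below
  search (suc d) k Pd+k below with P? k
  ... | yes Pk = k , Pk , below
  ... | no ¬Pk = search d (suc k) (subst P (sym (ℕ.+-suc d k)) Pd+k)
    λ m Pm → ℕ.≤∧≢⇒< (below m Pm) (λ k≡m → ¬Pk (subst P (sym k≡m) Pm))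

cliqueNumber-exists : (G : Graph n) → ∃ (IsLargestSize (IsClique G))
cliqueNumber-exists G =
  largestSize (isClique? G) (⊥ , λ _ _ u∈⊥ → contradiction u∈⊥ ∉⊥)

chromaticNumber-exists : (G : Graph n) → ∃ (IsLeast (Colourable G))
chromaticNumber-exists {n} G = least (colourable? G) (n , colourable-n G)

-- ω, χ, c and i are opaque so that Agda can infer G and v from them; the
-- accompanying -spec lemmas determine them completely.
opaque
  ω : Graph n → ℕ
  ω G = proj₁ (cliqueNumber-exists G)

  ω-spec : (G : Graph n) → IsLargestSize (IsClique G) (ω G)
  ω-spec G = proj₂ (cliqueNumber-exists G)

  χ : Graph n → ℕ
  χ G = proj₁ (chromaticNumber-exists G)

  χ-spec : (G : Graph n) → IsLeast (Colourable G) (χ G)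
  χ-spec G = proj₂ (chromaticNumber-exists G)

Perfect : Graph n → Set
Perfect G = ∀ S → χ (induced G S) ≡ ω (induced G S)

IsCliqueAt : (G : Graph n) (v : Fin n) → Pred (Subset n) 0ℓ
IsCliqueAt G v S = v ∈ S × IsClique G S

IsIndependentAt : (G : Graph n) (v : Fin n) → Pred (Subset n) 0ℓ
IsIndependentAt G v S = v ∈ S × IsIndependent G S

singleton-cliqueAt : (G : Graph n) (v : Fin n) → IsCliqueAt G v ⁅ v ⁆
singleton-cliqueAt G v = x∈⁅x⁆ v , λ u w u∈ w∈ u≢w → contradiction
  (trans (x∈⁅y⁆⇒x≡y v u∈) (sym (x∈⁅y⁆⇒x≡y v w∈))) u≢w

singleton-independentAt : (G : Graph n) (v : Fin n) →
                          IsIndependentAt G v ⁅ v ⁆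
singleton-independentAt G v = x∈⁅x⁆ v , λ u w u∈ w∈ →
  adj-irrefl G (trans (x∈⁅y⁆⇒x≡y v u∈) (sym (x∈⁅y⁆⇒x≡y v w∈)))

cliqueNumberAt-exists : (G : Graph n) (v : Fin n) →
                        ∃ (IsLargestSize (IsCliqueAt G v))
cliqueNumberAt-exists G v =
  largestSize (λ S → (v ∈? S) ×-dec isClique? G S)
              (⁅ v ⁆ , singleton-cliqueAt G v)

independenceNumberAt-exists : (G : Graph n) (v : Fin n) →
                              ∃ (IsLargestSize (IsIndependentAt G v))
independenceNumberAt-exists G v =
  largestSize (λ S → (v ∈? S) ×-dec isIndependent? G S)
              (⁅ v ⁆ , singleton-independentAt G v)

opaque
  c : Graph n → Fin n → ℕ
  c G v = proj₁ (cliqueNumberAt-exists G v)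

  c-spec : (G : Graph n) (v : Fin n) → IsLargestSize (IsCliqueAt G v) (c G v)
  c-spec G v = proj₂ (cliqueNumberAt-exists G v)

  i : Graph n → Fin n → ℕ
  i G v = proj₁ (independenceNumberAt-exists G v)

  i-spec : (G : Graph n) (v : Fin n) →
           IsLargestSize (IsIndependentAt G v) (i G v)
  i-spec G v = proj₂ (independenceNumberAt-exists G v)

c-nonZero : (G : Graph n) (v : Fin n) → NonZero (c G v)
c-nonZero G v = >-nonZero (subst (_≤ c G v) (∣⁅x⁆∣≡1 v)
  (proj₂ (c-spec G v) ⁅ v ⁆ (singleton-cliqueAt G v)))

i-nonZero : (G : Graph n) (v : Fin n) → NonZero (i G v)
i-nonZero G v = >-nonZero (subst (_≤ i G v) (∣⁅x⁆∣≡1 v)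
  (proj₂ (i-spec G v) ⁅ v ⁆ (singleton-independentAt G v)))

instance
  c*i-nonZero : {G : Graph n} {v : Fin n} → NonZero (c G v * i G v)
  c*i-nonZero {G = G} {v} =
    ℕ.m*n≢0 (c G v) (i G v) {{c-nonZero G v}} {{i-nonZero G v}}

{-# OPTIONS --safe #-}

-- Let N be a common multiple of all c v and i v.  The weights w v = N / c v
-- give every clique total weight at most N, so, G being perfect, N independent
-- sets suffice to cover each v exactly w v times.  Summing q v = N / i v over
-- any one independent set gives at most N, hence ∑ w v * q v ≤ N * N.
module Submission where

open import Defs
open import Data.Integer using (+_)
open import Data.Nat using (ℕ; _*_)
open import Data.Rational using (_/_; _≤_; 1ℚ)
open import Data.Rational.Properties using (+-0-monoid)
open import Algebra.Properties.Monoid.Sum +-0-monoid using (sum-syntax)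

open import Algebra.Properties.CommutativeSemigroup
  using (interchange; x∙yz≈y∙xz)
import Algebra.Properties.Semiring.Sum as SemiringSum
open import Data.Bool using (Bool; true; false)
open import Data.Fin using (Fin; zero; suc; toℕ)
open import Data.Fin.Properties as Fin using (all?; ¬∀⟶∃¬; toℕ-injective; toℕ<n)
open import Data.Fin.Subset
  using (Subset; inside; outside; ∣_∣; _∈_; _∉_; ⁅_⁆; _∩_; ∁)
open import Data.Fin.Subset.Properties
  using (_∈?_; nonempty?; x∈⁅x⁆; x∈⁅y⁆⇒x≡y; x∈p∩q⁻; x∈∁p⇒x∉p;
         ∣⁅x⁆∣≡1; ∣p∣≤n)
import Data.Integer as ℤ
import Data.Integer.Properties as ℤ
open import Data.Nat as ℕ using (zero; suc; _+_; _∸_; _<_; z≤n; s≤s; NonZero; _!)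
open import Data.Nat.Divisibility
  using (_∣_; quotient; m∣n⇒n≡quotient*m; m∣m*n; ∣-trans; m≤n⇒m!∣n!)
import Data.Nat.Properties as ℕ
open import Data.Product using (∃; _×_; _,_; proj₁; proj₂)
import Data.Rational as ℚ
import Data.Rational.Properties as ℚ
import Data.Rational.Unnormalised as ℚᵘ
import Data.Rational.Unnormalised.Properties as ℚᵘ
open import Data.Vec using ([]; _∷_; here; there; lookup; tabulate)
open import Data.Vec.Properties using ([]=⇒lookup; lookup⇒[]=; lookup∘tabulate)
open import Function using (_∘_)
open import Level using (0ℓ)
open import Relation.Binary.PropositionalEquality
open import Relation.Nullary using (Dec; yes; no; contradiction; does)
open import Relation.Nullary.Decidable using (dec-true)
open import Relation.Unary using (Pred; Decidable)

open SemiringSum ℕ.+-*-semiring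
  using (sum; sum-cong-≗; ∑-distrib-+; *-distribʳ-sum)

private
  variable
    k n : ℕ
    G : Graph n

-- Finite sums and weighted sums of natural numbers.

sum-mono-≤ : {f g : Fin n → ℕ} → (∀ v → f v ℕ.≤ g v) → sum f ℕ.≤ sum g
sum-mono-≤ {zero}  f≤g = z≤n
sum-mono-≤ {suc n} f≤g = ℕ.+-mono-≤ (f≤g zero) (sum-mono-≤ (f≤g ∘ suc))

sum-zero : {f : Fin n → ℕ} → (∀ v → f v ≡ 0) → sum f ≡ 0
sum-zero {zero}  f≡0 = refl
sum-zero {suc n} f≡0 = cong₂ _+_ (f≡0 zero) (sum-zero (f≡0 ∘ suc))

term≤sum : (f : Fin n → ℕ) (v : Fin n) → f v ℕ.≤ sum f
term≤sum f zero    = ℕ.m≤m+n (f zero) _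
term≤sum f (suc v) = ℕ.≤-trans (term≤sum (f ∘ suc) v) (ℕ.m≤n+m _ (f zero))

sum-≤1 : {f : Fin n → ℕ} → (∀ v → f v ℕ.≤ 1) →
         (∀ u v → 0 < f u → 0 < f v → u ≡ v) → sum f ℕ.≤ 1
sum-≤1 {zero} f≤1 unique = z≤n
sum-≤1 {suc n} {f} f≤1 unique with f zero in eq
... | zero  = sum-≤1 (f≤1 ∘ suc)
  λ u v 0<u 0<v → Fin.suc-injective (unique (suc u) (suc v) 0<u 0<v)
... | suc m = subst (λ s → suc m + s ℕ.≤ 1) (sym rest≡0)
  (subst (ℕ._≤ 1) (trans eq (sym (ℕ.+-identityʳ (suc m)))) (f≤1 zero))
  where
  rest≡0 : sum (f ∘ suc) ≡ 0
  rest≡0 = sum-zero λ v → ℕ.n≤0⇒n≡0 (ℕ.≮⇒≥ λ 0<fv →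
    contradiction (unique zero (suc v) (subst (0 <_) (sym eq) (s≤s z≤n)) 0<fv) λ ())

infix 8 _∙_
-- With an indicator on one side this is a total over a set: `w ∙ 𝟙 K` is the `w`-weight of `K`, and
-- `𝟙 S ∙ q` sums `q` over `S`.
_∙_ : (w q : Fin n → ℕ) → ℕ
w ∙ q = sum λ v → w v * q v

∙-comm : (w q : Fin n → ℕ) → w ∙ q ≡ q ∙ w
∙-comm w q = sum-cong-≗ λ v → ℕ.*-comm (w v) (q v)

∙-monoˡ-≤ : {w w′ : Fin n → ℕ} (q : Fin n → ℕ) →
            (∀ v → w v ℕ.≤ w′ v) → w ∙ q ℕ.≤ w′ ∙ q
∙-monoˡ-≤ q w≤w′ = sum-mono-≤ λ v → ℕ.*-monoˡ-≤ (q v) (w≤w′ v)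

sum-+ : (w a b : Fin n → ℕ) → (∀ v → w v ≡ a v + b v) → sum w ≡ sum a + sum b
sum-+ w a b eq = trans (sum-cong-≗ eq) (∑-distrib-+ a b)

∙-+ : (w a b q : Fin n → ℕ) → (∀ v → w v ≡ a v + b v) →
      w ∙ q ≡ a ∙ q + b ∙ q
∙-+ w a b q eq = sum-+ _ _ _ λ v →
  trans (cong (_* q v) (eq v)) (ℕ.*-distribʳ-+ (q v) (a v) (b v))

-- Indicator functions of vertex sets.

bit : Bool → ℕ
bit false = 0
bit true  = 1

𝟙 : Subset n → Fin n → ℕ
𝟙 S v = bit (lookup S v)

𝟙≤1 : (S : Subset n) (v : Fin n) → 𝟙 S v ℕ.≤ 1
𝟙≤1 S v with lookup S v
... | false = z≤n
... | true  = s≤s z≤n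

𝟙-∈ : {S : Subset n} {v : Fin n} → v ∈ S → 𝟙 S v ≡ 1
𝟙-∈ v∈S = cong bit ([]=⇒lookup v∈S)

𝟙>0⇒∈ : (S : Subset n) {v : Fin n} → 0 < 𝟙 S v → v ∈ S
𝟙>0⇒∈ S {v} 0<𝟙 with lookup S v in eq
... | true = lookup⇒[]= v S eq

𝟙-∉ : {S : Subset n} {v : Fin n} → v ∉ S → 𝟙 S v ≡ 0
𝟙-∉ {S = S} v∉S = ℕ.n≤0⇒n≡0 (ℕ.≮⇒≥ (v∉S ∘ 𝟙>0⇒∈ S))

sum-𝟙 : (S : Subset n) → sum (𝟙 S) ≡ ∣ S ∣
sum-𝟙 []            = refl
sum-𝟙 (inside  ∷ S) = cong suc (sum-𝟙 S)
sum-𝟙 (outside ∷ S) = sum-𝟙 S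

𝟙-split : (S T : Subset n) (v : Fin n) →
          𝟙 S v ≡ 𝟙 (S ∩ T) v + 𝟙 (S ∩ ∁ T) v
𝟙-split (inside  ∷ S) (inside  ∷ T) zero = refl
𝟙-split (inside  ∷ S) (outside ∷ T) zero = refl
𝟙-split (outside ∷ S) (_       ∷ T) zero = refl
𝟙-split (_ ∷ S) (_ ∷ T) (suc v) = 𝟙-split S T v

comprehension : {P : Pred (Fin n) 0ℓ} → Decidable P → Subset n
comprehension P? = tabulate (does ∘ P?)

module _ {P : Pred (Fin n) 0ℓ} (P? : Decidable P) {v : Fin n} where

  ∈-comprehension⁺ : P v → v ∈ comprehension P?
  ∈-comprehension⁺ Pv = lookup⇒[]= v _
    (trans (lookup∘tabulate (does ∘ P?) v) (dec-true (P? v) Pv))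

  ∈-comprehension⁻ : v ∈ comprehension P? → P v
  ∈-comprehension⁻ v∈ with P? v | trans (sym (lookup∘tabulate (does ∘ P?) v)) ([]=⇒lookup v∈)
  ... | yes Pv | _ = Pv

-- Exact covers by independent sets.

-- A list of `k` independent sets, repetitions allowed, in which each `v` occurs exactly `w v`
-- times. The weights are tied together by pointwise equations, so no function extensionality is
-- needed.
data Cover (G : Graph n) : ℕ → (Fin n → ℕ) → Set where
  empty : ∀ {w} → (∀ v → w v ≡ 0) → Cover G 0 w
  add   : ∀ {k w r} S → IsIndependent G S → (∀ v → w v ≡ 𝟙 S v + r v) →
          Cover G k r → Cover G (suc k) w

-- Double counting: `w` is the sum of the indicators of the `k` members, and each member contributes
-- at most `b`.
Cover-∙ : {w : Fin n → ℕ} (q : Fin n → ℕ) {b : ℕ} →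
          (∀ S → IsIndependent G S → 𝟙 S ∙ q ℕ.≤ b) →
          Cover G k w → w ∙ q ℕ.≤ k * b
Cover-∙ q bound (empty w≡0) =
  ℕ.≤-reflexive (sum-zero λ v → cong (_* q v) (w≡0 v))
Cover-∙ {w = w} q bound (add {r = r} S indep eq C) =
  ℕ.≤-trans (ℕ.≤-reflexive (∙-+ w (𝟙 S) r q eq))
            (ℕ.+-mono-≤ (bound S indep) (Cover-∙ q bound C))

-- Two distinct common vertices would be adjacent in the clique and non-adjacent in the independent
-- set.
independent∙clique≤1 : (G : Graph n) {S K : Subset n} →
  IsIndependent G S → IsClique G K → 𝟙 S ∙ 𝟙 K ℕ.≤ 1
independent∙clique≤1 G {S} {K} indep clique =
  sum-≤1 (λ v → ℕ.*-mono-≤ (𝟙≤1 S v) (𝟙≤1 K v)) unique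
  where
  both : ∀ v → 0 < 𝟙 S v * 𝟙 K v → v ∈ S × v ∈ K
  both v 0<p =
    𝟙>0⇒∈ S (ℕ.n≢0⇒n>0 λ eq → ℕ.<⇒≢ 0<p (sym (cong (_* 𝟙 K v) eq))) ,
    𝟙>0⇒∈ K (ℕ.n≢0⇒n>0 λ eq → ℕ.<⇒≢ 0<p
      (sym (trans (cong (𝟙 S v *_) eq) (ℕ.*-zeroʳ (𝟙 S v)))))

  unique : ∀ u v → 0 < 𝟙 S u * 𝟙 K u → 0 < 𝟙 S v * 𝟙 K v → u ≡ v
  unique u v pu pv with both u pu | both v pv | u Fin.≟ v
  ... | _           | _           | yes u≡v = u≡v
  ... | u∈S , u∈K | v∈S , v∈K | no  u≢v =
    contradiction (clique u v u∈K v∈K u≢v) (indep u v u∈S v∈S)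

-- Each of the `k` members meets `K` at most once. This is the easy converse of `perfect⇒Cover`,
-- valid in every graph.
clique∙Cover≤ : {w : Fin n → ℕ} {K : Subset n} → IsClique G K →
                Cover G k w → w ∙ 𝟙 K ℕ.≤ k
clique∙Cover≤ {G = G} {k = k} {K = K} clique C =
  subst (_ ℕ.≤_) (ℕ.*-identityʳ k)
    (Cover-∙ (𝟙 K) (λ S indep → independent∙clique≤1 G indep clique) C)

record Extraction (G : Graph n) (k : ℕ) (w : Fin n → ℕ) (v : Fin n) : Set where
  constructor extraction
  field
    {k′}        : ℕ
    {S}         : Subset n
    {r}         : Fin n → ℕ
    k≡1+k′      : k ≡ suc k′
    v∈S         : v ∈ S
    independent : IsIndependent G S
    split       : ∀ u → w u ≡ 𝟙 S u + r u
    cover       : Cover G k′ r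

-- Positive weight at `v` means that some member contains `v`. The first such member is moved to the
-- front, and those passed over are put back behind it.
extract : {w : Fin n → ℕ} {v : Fin n} → 0 < w v → Cover G k w →
          Extraction G k w v
extract {v = v} 0<wv (empty w≡0) = contradiction (sym (w≡0 v)) (ℕ.<⇒≢ 0<wv)
extract {v = v} 0<wv (add {r = r} S indep eq C) with v ∈? S
... | yes v∈S = extraction refl v∈S indep eq C
-- `S` misses `v`, so `r v` equals `w v` and is still positive.
... | no  v∉S with extract {v = v} (subst (0 <_) (trans (eq v) (cong (_+ r v) (𝟙-∉ v∉S))) 0<wv) C
...   | extraction {S = T} {r = s} refl v∈T indepT eqT D =
  extraction refl v∈T indepT
    (λ u → trans (eq u) (trans (cong (𝟙 S u ℕ.+_) (eqT u))
      (x∙yz≈y∙xz ℕ.+-commutativeSemigroup (𝟙 S u) (𝟙 T u) (s u))))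
    (add S indep (λ _ → refl) D)

-- From perfection to covers of a vertex set.

-- The members are the colour classes: the class of the top colour is split off and the rest of `A`
-- uses smaller colours. Classes may be empty, so `k` may be any strict upper bound on the colours.
colouring⇒Cover : (G : Graph n) (f : Fin n → ℕ) (k : ℕ) (A : Subset n) →
  (∀ v → v ∈ A → f v < k) →
  (∀ u v → u ∈ A → v ∈ A → Adj G u v → f u ≢ f v) →
  Cover G k (𝟙 A)
colouring⇒Cover G f zero A f<k proper =
  empty λ v → 𝟙-∉ λ v∈A → ℕ.n≮0 (f<k v v∈A)
colouring⇒Cover G f (suc k) A f<k proper =
  add (A ∩ T) indep (𝟙-split A T) (colouring⇒Cover G f k (A ∩ ∁ T) f<k′
    λ u v u∈ v∈ → proper u v (proj₁ (x∈p∩q⁻ A _ u∈)) (proj₁ (x∈p∩q⁻ A _ v∈)))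
  where
  inClass? : ∀ v → Dec (f v ≡ k)
  inClass? v = f v ℕ.≟ k

  T = comprehension inClass?

  indep : IsIndependent G (A ∩ T)
  indep u v u∈ v∈ uv with x∈p∩q⁻ A T u∈ | x∈p∩q⁻ A T v∈
  ... | u∈A , u∈T | v∈A , v∈T = proper u v u∈A v∈A uv
    (trans (∈-comprehension⁻ inClass? u∈T) (sym (∈-comprehension⁻ inClass? v∈T)))

  f<k′ : ∀ v → v ∈ A ∩ ∁ T → f v < k
  f<k′ v v∈ with x∈p∩q⁻ A (∁ T) v∈
  ... | v∈A , v∈∁T = ℕ.≤∧≢⇒< (ℕ.≤-pred (f<k v v∈A))
    (x∈∁p⇒x∉p v∈∁T ∘ ∈-comprehension⁺ inClass?)

embed : (A : Subset n) → Subset ∣ A ∣ → Subset n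
embed []            S       = []
embed (inside  ∷ A) (s ∷ S) = s ∷ embed A S
embed (outside ∷ A) S       = outside ∷ embed A S

∣embed∣ : (A : Subset n) (S : Subset ∣ A ∣) → ∣ embed A S ∣ ≡ ∣ S ∣
∣embed∣ []            []            = refl
∣embed∣ (inside  ∷ A) (inside  ∷ S) = cong suc (∣embed∣ A S)
∣embed∣ (inside  ∷ A) (outside ∷ S) = ∣embed∣ A S
∣embed∣ (outside ∷ A) S             = ∣embed∣ A S

∈-embed⁻ : (A : Subset n) (S : Subset ∣ A ∣) {v : Fin n} → v ∈ embed A S →
           ∃ λ j → j ∈ S × element A j ≡ v
∈-embed⁻ (inside ∷ A) (s ∷ S) here = zero , here , refl
∈-embed⁻ (inside ∷ A) (s ∷ S) (there v∈) with ∈-embed⁻ A S v∈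
... | j , j∈S , eq = suc j , there j∈S , cong suc eq
∈-embed⁻ (outside ∷ A) S (there v∈) with ∈-embed⁻ A S v∈
... | j , j∈S , eq = j , j∈S , cong suc eq

embed-clique : (G : Graph n) (A : Subset n) {S : Subset ∣ A ∣} →
               IsClique (induced G A) S → IsClique G (embed A S)
embed-clique G A {S} clique u v u∈ v∈ u≢v with ∈-embed⁻ A S u∈ | ∈-embed⁻ A S v∈
... | a , a∈S , refl | b , b∈S , refl =
  clique a b a∈S b∈S (u≢v ∘ cong (element A))

-- The embedded set lies inside `A`, so the factor `𝟙 A` changes nothing. This turns the size of a
-- clique of `induced G A` into a clique weight in `G`.
𝟙∙𝟙-embed : (A : Subset n) (S : Subset ∣ A ∣) → 𝟙 A ∙ 𝟙 (embed A S) ≡ ∣ S ∣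
𝟙∙𝟙-embed A S = trans (sum-cong-≗ absorb) (trans (sum-𝟙 (embed A S)) (∣embed∣ A S))
  where
  absorb : ∀ v → 𝟙 A v * 𝟙 (embed A S) v ≡ 𝟙 (embed A S) v
  absorb v with v ∈? embed A S
  ... | no  v∉ = trans (cong (𝟙 A v *_) (𝟙-∉ v∉))
                       (trans (ℕ.*-zeroʳ (𝟙 A v)) (sym (𝟙-∉ v∉)))
  ... | yes v∈ with ∈-embed⁻ A S v∈
  ...   | j , _ , refl = trans (cong (_* 𝟙 (embed A S) v) (𝟙-∈ (element-∈ A j)))
                               (ℕ.*-identityˡ _)

-- Off `A` the value is the placeholder 0; `colouring⇒Cover` constrains colours on `A` alone.
extend : (A : Subset n) → (Fin ∣ A ∣ → ℕ) → Fin n → ℕ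
extend (inside  ∷ A) f zero    = f zero
extend (inside  ∷ A) f (suc v) = extend A (f ∘ suc) v
extend (outside ∷ A) f zero    = 0
extend (outside ∷ A) f (suc v) = extend A f v

extend-element : (A : Subset n) (f : Fin ∣ A ∣ → ℕ) (j : Fin ∣ A ∣) →
                 extend A f (element A j) ≡ f j
extend-element (inside  ∷ A) f zero    = refl
extend-element (inside  ∷ A) f (suc j) = extend-element A (f ∘ suc) j
extend-element (outside ∷ A) f j       = extend-element A f j

-- A largest clique of `induced G A` is a clique of `G` inside `A`, so its size is at most `k`.
-- Perfection then gives `χ ≤ k`, and an optimal colouring supplies the cover.
perfect⇒Cover-𝟙 : (G : Graph n) → Perfect G → (k : ℕ) (A : Subset n) →
  (∀ K → IsClique G K → 𝟙 A ∙ 𝟙 K ℕ.≤ k) → Cover G k (𝟙 A)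
perfect⇒Cover-𝟙 G perfect k A bound =
  colouring⇒Cover G (extend A colour) k A bounded proper
  where
  H = induced G A

  χ≤k : χ H ℕ.≤ k
  χ≤k with proj₁ (ω-spec H)
  ... | S , clique , ∣S∣≡ω = begin
    χ H                  ≡⟨ perfect A ⟩
    ω H                  ≡⟨ ∣S∣≡ω ⟨
    ∣ S ∣                ≡⟨ 𝟙∙𝟙-embed A S ⟨
    𝟙 A ∙ 𝟙 (embed A S)  ≤⟨ bound (embed A S) (embed-clique G A clique) ⟩
    k                    ∎
    where open ℕ.≤-Reasoning

  colouring = proj₁ (χ-spec H)

  colour : Fin ∣ A ∣ → ℕ
  colour = toℕ ∘ proj₁ colouring

  bounded : ∀ v → v ∈ A → extend A colour v < k
  bounded v v∈A with element-surjective A v∈A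
  ... | j , refl = subst (_< k) (sym (extend-element A colour j))
                         (ℕ.<-≤-trans (toℕ<n _) χ≤k)

  proper : ∀ u v → u ∈ A → v ∈ A → Adj G u v →
           extend A colour u ≢ extend A colour v
  proper u v u∈A v∈A uv eq with element-surjective A u∈A | element-surjective A v∈A
  ... | a , refl | b , refl = proj₂ colouring a b uv (toℕ-injective
    (trans (sym (extend-element A colour a)) (trans eq (extend-element A colour b))))

-- Covers for arbitrary integer weights.

Cover-cong : {w w′ : Fin n → ℕ} → (∀ v → w v ≡ w′ v) → Cover G k w → Cover G k w′
Cover-cong eq (empty w≡0)        = empty λ v → trans (sym (eq v)) (w≡0 v)
Cover-cong eq (add S indep sp C) = add S indep (λ v → trans (sym (eq v)) (sp v)) C

CliqueWeights≤ : Graph n → ℕ → (Fin n → ℕ) → Set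
CliqueWeights≤ G k w = ∀ K → IsClique G K → w ∙ 𝟙 K ℕ.≤ k

-- A cover of w − 𝟙 ⁅ v ⁆ has a member S containing v, and the remaining k − 1
-- sets cover some r.  A clique avoiding v has r-weight at most k − 1, and one
-- through v meets S in v, so r + 𝟙 ⁅ v ⁆ satisfies the hypothesis with k − 1;
-- adding S to a cover of it covers w.
Cover-step : (G : Graph n) (k : ℕ) (w : Fin n → ℕ) {v : Fin n} → 1 < w v →
  (∀ k′ w′ → sum w′ < sum w → CliqueWeights≤ G k′ w′ → Cover G k′ w′) →
  CliqueWeights≤ G k w → Cover G k w
Cover-step {n} G k w {v} 1<wv rec bound = finish (extract 0<w⁻v (rec k w⁻ w⁻<w w⁻-bound))
  where
  e w⁻ : Fin n → ℕ
  e = 𝟙 ⁅ v ⁆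
  w⁻ u = w u ∸ e u

  e-v : e v ≡ 1
  e-v = 𝟙-∈ (x∈⁅x⁆ v)

  sum-e : sum e ≡ 1
  sum-e = trans (sum-𝟙 ⁅ v ⁆) (∣⁅x⁆∣≡1 v)

  e≤w : ∀ u → e u ℕ.≤ w u
  e≤w u with u ∈? ⁅ v ⁆
  ... | no  u∉ = subst (ℕ._≤ w u) (sym (𝟙-∉ u∉)) z≤n
  ... | yes u∈ with x∈⁅y⁆⇒x≡y v u∈
  ...   | refl = ℕ.≤-trans (𝟙≤1 ⁅ v ⁆ v) (ℕ.<⇒≤ 1<wv)

  w≡e+w⁻ : ∀ u → w u ≡ e u + w⁻ u
  w≡e+w⁻ u = sym (ℕ.m+[n∸m]≡n (e≤w u))

  -- A weight of at least 2 at `v` survives the subtraction, so `extract` applies to the cover of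
  -- `w⁻`.
  0<w⁻v : 0 < w⁻ v
  0<w⁻v = ℕ.m<n⇒0<n∸m (subst (_< w v) (sym e-v) 1<wv)

  w⁻<w : sum w⁻ < sum w
  w⁻<w = ℕ.≤-reflexive (sym (trans (sum-+ w e w⁻ w≡e+w⁻) (cong (_+ sum w⁻) sum-e)))

  w⁻-bound : CliqueWeights≤ G k w⁻
  w⁻-bound K clique =
    ℕ.≤-trans (∙-monoˡ-≤ (𝟙 K) λ u → ℕ.m∸n≤m (w u) (e u)) (bound K clique)

  finish : Extraction G k w⁻ v → Cover G k w
  finish (extraction {k′} {S} {r} refl v∈S indep w⁻≡𝟙S+r cover) =
    add S indep w≡𝟙S+w″ (rec k′ w″ w″<w w″-bound)
    where
    w″ : Fin n → ℕ
    w″ u = e u + r u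

    w≡𝟙S+w″ : ∀ u → w u ≡ 𝟙 S u + w″ u
    w≡𝟙S+w″ u = trans (w≡e+w⁻ u) (trans (cong (e u ℕ.+_) (w⁻≡𝟙S+r u))
      (x∙yz≈y∙xz ℕ.+-commutativeSemigroup (e u) (𝟙 S u) (r u)))

    -- `S` contains `v`, so removing its indicator strictly lowers the total.
    w″<w : sum w″ < sum w
    w″<w = subst (sum w″ <_) (sym (sum-+ w (𝟙 S) w″ w≡𝟙S+w″))
      (ℕ.m<n+m (sum w″) (subst (ℕ._≤ sum (𝟙 S)) (𝟙-∈ v∈S) (term≤sum (𝟙 S) v)))

    w″-bound : CliqueWeights≤ G k′ w″
    w″-bound K clique with v ∈? K
    ... | yes v∈K = ℕ.≤-pred (begin
      suc (w″ ∙ 𝟙 K)         ≤⟨ ℕ.+-monoˡ-≤ (w″ ∙ 𝟙 K) meet ⟩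
      𝟙 S ∙ 𝟙 K + w″ ∙ 𝟙 K   ≡⟨ ∙-+ w (𝟙 S) w″ (𝟙 K) w≡𝟙S+w″ ⟨
      w ∙ 𝟙 K                ≤⟨ bound K clique ⟩
      suc k′                 ∎)
      where
      open ℕ.≤-Reasoning
      meet : 1 ℕ.≤ 𝟙 S ∙ 𝟙 K
      meet = subst (ℕ._≤ 𝟙 S ∙ 𝟙 K) (cong₂ _*_ (𝟙-∈ v∈S) (𝟙-∈ v∈K))
                   (term≤sum (λ u → 𝟙 S u * 𝟙 K u) v)
    ... | no  v∉K = begin
      w″ ∙ 𝟙 K               ≡⟨ ∙-+ w″ e r (𝟙 K) (λ _ → refl) ⟩
      e ∙ 𝟙 K + r ∙ 𝟙 K      ≡⟨ cong (_+ r ∙ 𝟙 K) (sum-zero miss) ⟩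
      r ∙ 𝟙 K                ≤⟨ clique∙Cover≤ clique cover ⟩
      k′                     ∎
      where
      open ℕ.≤-Reasoning
      miss : ∀ u → e u * 𝟙 K u ≡ 0
      miss u with u ∈? ⁅ v ⁆
      ... | no  u∉ = cong (_* 𝟙 K u) (𝟙-∉ u∉)
      ... | yes u∈ with x∈⁅y⁆⇒x≡y v u∈
      ...   | refl = trans (cong (e v *_) (𝟙-∉ v∉K)) (ℕ.*-zeroʳ (e v))

-- The base case: a weight with values 0 and 1 is the indicator of its support.
perfect⇒Cover-≤1 : (G : Graph n) → Perfect G → (k : ℕ) (w : Fin n → ℕ) →
  (∀ v → w v ℕ.≤ 1) → CliqueWeights≤ G k w → Cover G k w
perfect⇒Cover-≤1 G perfect k w w≤1 bound =
  Cover-cong 𝟙A≡w (perfect⇒Cover-𝟙 G perfect k A λ K clique → subst (ℕ._≤ k)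
    (sum-cong-≗ λ v → cong (_* 𝟙 K v) (sym (𝟙A≡w v))) (bound K clique))
  where
  positive? : ∀ v → Dec (0 < w v)
  positive? v = 0 ℕ.<? w v

  A = comprehension positive?

  𝟙A≡w : ∀ v → 𝟙 A v ≡ w v
  𝟙A≡w v with 0 ℕ.<? w v
  ... | yes 0<wv = trans (𝟙-∈ (∈-comprehension⁺ positive? 0<wv))
                         (ℕ.≤-antisym 0<wv (w≤1 v))
  ... | no  0≮wv = trans (𝟙-∉ (0≮wv ∘ ∈-comprehension⁻ positive?))
                         (sym (ℕ.n≤0⇒n≡0 (ℕ.≮⇒≥ 0≮wv)))

-- This amounts to Lovász's replication lemma: such a cover is a `k`-colouring of the graph in which
-- each `v` becomes a clique of `w v` copies. Here the blown-up graph is never built; `Cover-step`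
-- lowers the total weight until all weights are at most 1.
perfect⇒Cover : (G : Graph n) → Perfect G → (k : ℕ) (w : Fin n → ℕ) →
                CliqueWeights≤ G k w → Cover G k w
perfect⇒Cover {n} G perfect k w = go (suc (sum w)) k w ℕ.≤-refl
  where
  -- Strong induction on `sum w`, with `t` as a strict bound; `k` varies too, since `Cover-step`
  -- recurses with a smaller one.
  go : ∀ t k w → sum w < t → CliqueWeights≤ G k w → Cover G k w
  go (suc t) k w w<t bound with all? (λ v → w v ℕ.≤? 1)
  ... | yes w≤1 = perfect⇒Cover-≤1 G perfect k w w≤1 bound
  ... | no  w≰1 with ¬∀⟶∃¬ n _ (λ v → w v ℕ.≤? 1) w≰1
  ...   | v , wv≰1 = Cover-step G k w (ℕ.≰⇒> wv≰1)
    (λ k′ w′ w′<w → go t k′ w′ (ℕ.<-≤-trans w′<w (ℕ.≤-pred w<t))) bound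

-- Sums of scaled reciprocals over cliques and independent sets.

-- For `v ∈ S` the number `q v = N / d v` is at most `N / ∣ S ∣`, and there are `∣ S ∣` such terms.
-- To avoid division both sides are multiplied by `∣ S ∣`, which is why empty `S` is treated
-- separately.
𝟙∙reciprocals≤ : (S : Subset n) (d q : Fin n → ℕ) {N : ℕ} →
  (∀ v → v ∈ S → ∣ S ∣ ℕ.≤ d v) → (∀ v → q v * d v ≡ N) → 𝟙 S ∙ q ℕ.≤ N
𝟙∙reciprocals≤ S d q {N} ∣S∣≤d qd≡N with nonempty? S
... | no  S-empty = ℕ.≤-trans (ℕ.≤-reflexive (sum-zero λ v →
  cong (_* q v) (𝟙-∉ λ v∈S → S-empty (v , v∈S)))) z≤n
... | yes (u , u∈S) = ℕ.*-cancelʳ-≤ (𝟙 S ∙ q) N ∣ S ∣ {{ℕ.>-nonZero 0<∣S∣}} (begin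
  𝟙 S ∙ q * ∣ S ∣                     ≡⟨ *-distribʳ-sum ∣ S ∣ (λ v → 𝟙 S v * q v) ⟩
  sum (λ v → 𝟙 S v * q v * ∣ S ∣)     ≤⟨ sum-mono-≤ term ⟩
  sum (λ v → 𝟙 S v * N)               ≡⟨ *-distribʳ-sum N (𝟙 S) ⟨
  sum (𝟙 S) * N                       ≡⟨ cong (_* N) (sum-𝟙 S) ⟩
  ∣ S ∣ * N                           ≡⟨ ℕ.*-comm ∣ S ∣ N ⟩
  N * ∣ S ∣                           ∎)
  where
  open ℕ.≤-Reasoning
  0<∣S∣ : 0 < ∣ S ∣
  0<∣S∣ = subst₂ ℕ._≤_ (𝟙-∈ u∈S) (sum-𝟙 S) (term≤sum (𝟙 S) u)

  term : ∀ v → 𝟙 S v * q v * ∣ S ∣ ℕ.≤ 𝟙 S v * N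
  term v with v ∈? S
  ... | no  v∉S = subst (λ b → b * q v * ∣ S ∣ ℕ.≤ b * N) (sym (𝟙-∉ v∉S)) z≤n
  ... | yes v∈S = begin
    𝟙 S v * q v * ∣ S ∣    ≡⟨ ℕ.*-assoc (𝟙 S v) (q v) ∣ S ∣ ⟩
    𝟙 S v * (q v * ∣ S ∣)  ≤⟨ ℕ.*-monoʳ-≤ (𝟙 S v) (ℕ.*-monoʳ-≤ (q v) (∣S∣≤d v v∈S)) ⟩
    𝟙 S v * (q v * d v)    ≡⟨ cong (𝟙 S v *_) (qd≡N v) ⟩
    𝟙 S v * N              ∎

-- `𝟙∙reciprocals≤` serves twice: on cliques it justifies the cover of `w` by `N` sets, on
-- independent sets it bounds each member's `q`-total.
perfect⇒∙≤ : (G : Graph n) → Perfect G → {N : ℕ} (w q : Fin n → ℕ) →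
  (∀ v → w v * c G v ≡ N) → (∀ v → q v * i G v ≡ N) → w ∙ q ℕ.≤ N * N
perfect⇒∙≤ G perfect {N} w q wc≡N qi≡N =
  Cover-∙ q independent≤ (perfect⇒Cover G perfect N w clique≤)
  where
  independent≤ : ∀ S → IsIndependent G S → 𝟙 S ∙ q ℕ.≤ N
  independent≤ S indep = 𝟙∙reciprocals≤ S (i G) q
    (λ v v∈S → proj₂ (i-spec G v) S (v∈S , indep)) qi≡N

  clique≤ : CliqueWeights≤ G N w
  clique≤ K clique = subst (ℕ._≤ N) (∙-comm (𝟙 K) w) (𝟙∙reciprocals≤ K (c G) w
    (λ v v∈K → proj₂ (c-spec G v) K (v∈K , clique)) wc≡N)

-- The common multiple will be `n !`, since every `c G v` and `i G v` lies between 1 and `n`.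
m≤n⇒m∣n! : {m n : ℕ} .{{_ : NonZero m}} → m ℕ.≤ n → m ∣ n !
m≤n⇒m∣n! {suc m} m≤n = ∣-trans (m∣m*n (m !)) (m≤n⇒m!∣n! m≤n)

n!/ : (d : Fin n → ℕ) → (∀ v → d v ∣ n !) → ∃ λ q → ∀ v → q v * d v ≡ n !
n!/ d d∣n! = (λ v → quotient (d∣n! v)) , λ v → sym (m∣n⇒n≡quotient*m (d∣n! v))

c∣n! : (G : Graph n) (v : Fin n) → c G v ∣ n !
c∣n! G v = m≤n⇒m∣n! {{c-nonZero G v}} c≤n
  where
  c≤n : c G v ℕ.≤ _
  c≤n with proj₁ (c-spec G v)
  ... | S , _ , ∣S∣≡c = subst (ℕ._≤ _) ∣S∣≡c (∣p∣≤n S)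

i∣n! : (G : Graph n) (v : Fin n) → i G v ∣ n !
i∣n! G v = m≤n⇒m∣n! {{i-nonZero G v}} i≤n
  where
  i≤n : i G v ℕ.≤ _
  i≤n with proj₁ (i-spec G v)
  ... | S , _ , ∣S∣≡i = subst (ℕ._≤ _) ∣S∣≡i (∣p∣≤n S)

-- Rational arithmetic over a common denominator.

/-≡ : (a b : ℕ) {d e : ℕ} .{{_ : NonZero d}} .{{_ : NonZero e}} →
      a * e ≡ b * d → + a / d ≡ + b / e
/-≡ a b {suc d} {suc e} eq = ℚ.fromℚᵘ-cong {ℚᵘ.mkℚᵘ (+ a) d} {ℚᵘ.mkℚᵘ (+ b) e} (ℚᵘ.*≡* (begin
  + a ℤ.* + suc e  ≡⟨ ℤ.pos-* a (suc e) ⟨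
  + (a * suc e)    ≡⟨ cong +_ eq ⟩
  + (b * suc d)    ≡⟨ ℤ.pos-* b (suc d) ⟩
  + b ℤ.* + suc d  ∎))
  where open ≡-Reasoning

-- `_/_` reduces to lowest terms, so the sum is compared among unnormalised fractions, by
-- cross-multiplication.
/-homo-+ : (a b M : ℕ) .{{_ : NonZero M}} →
           + a / M ℚ.+ + b / M ≡ + (a + b) / M
/-homo-+ a b (suc M) = ℚ.toℚᵘ-injective (begin
  ℚ.toℚᵘ (ℚ.fromℚᵘ x ℚ.+ ℚ.fromℚᵘ y)                ≈⟨ ℚ.toℚᵘ-homo-+ (ℚ.fromℚᵘ x) (ℚ.fromℚᵘ y) ⟩
  ℚ.toℚᵘ (ℚ.fromℚᵘ x) ℚᵘ.+ ℚ.toℚᵘ (ℚ.fromℚᵘ y)      ≈⟨ ℚᵘ.+-cong (ℚ.toℚᵘ-fromℚᵘ x) (ℚ.toℚᵘ-fromℚᵘ y) ⟩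
  x ℚᵘ.+ y                                          ≈⟨ ℚᵘ.*≡* common ⟩
  ℚᵘ.mkℚᵘ (+ (a + b)) M                             ≈⟨ ℚ.toℚᵘ-fromℚᵘ _ ⟨
  ℚ.toℚᵘ (ℚ.fromℚᵘ (ℚᵘ.mkℚᵘ (+ (a + b)) M))         ∎)
  where
  open import Relation.Binary.Reasoning.Setoid ℚᵘ.≃-setoid
  x = ℚᵘ.mkℚᵘ (+ a) M
  y = ℚᵘ.mkℚᵘ (+ b) M
  m = + suc M
  common : (+ a ℤ.* m ℤ.+ + b ℤ.* m) ℤ.* m ≡ (+ a ℤ.+ + b) ℤ.* (m ℤ.* m)
  common = trans (cong (ℤ._* m) (sym (ℤ.*-distribʳ-+ m (+ a) (+ b))))
                 (ℤ.*-assoc (+ a ℤ.+ + b) m m)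

0/ : (M : ℕ) .{{_ : NonZero M}} → + 0 / M ≡ ℚ.0ℚ
0/ M = /-≡ 0 0 {M} {1} refl

-- Each `1 / d v` equals `a v / M`, so only the numerators remain to be added.
∑-reciprocals : (M : ℕ) .{{_ : NonZero M}} {n : ℕ} (a d : Fin n → ℕ)
  (d≢0 : ∀ v → NonZero (d v)) → (∀ v → a v * d v ≡ M) →
  ∑[ v < n ] (_/_ (+ 1) (d v) {{d≢0 v}}) ≡ + sum a / M
∑-reciprocals M {zero}  a d d≢0 ad≡M = sym (0/ M)
∑-reciprocals M {suc n} a d d≢0 ad≡M = trans
  (cong₂ ℚ._+_
    (/-≡ 1 (a zero) {{d≢0 zero}} (trans (ℕ.*-identityˡ M) (sym (ad≡M zero))))
    (∑-reciprocals M (a ∘ suc) (d ∘ suc) (d≢0 ∘ suc) (ad≡M ∘ suc)))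
  (/-homo-+ (a zero) (sum (a ∘ suc)) M)

/≤1 : (a M : ℕ) .{{_ : NonZero M}} → a ℕ.≤ M → + a / M ≤ 1ℚ
/≤1 a (suc M) a≤M = ℚ.toℚᵘ-cancel-≤ (ℚᵘ.≤-respˡ-≃ (ℚᵘ.≃-sym (ℚ.toℚᵘ-fromℚᵘ (ℚᵘ.mkℚᵘ (+ a) M)))
  (ℚᵘ.*≤* (subst₂ ℤ._≤_ (sym (ℤ.*-identityʳ (+ a))) (sym (ℤ.*-identityˡ (+ suc M)))
    (ℤ.+≤+ a≤M))))

theorem9 : (n : ℕ) (G : Graph n) → Perfect G →
    ∑[ v < n ] ((+ 1) / (c G v * i G v)) ≤ 1ℚ
theorem9 n G perfect with n!/ (c G) (c∣n! G) | n!/ (i G) (i∣n! G)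
-- Over the denominator `n ! * n !` the term at `v` has numerator `w v * q v`, so the numerators sum
-- to `w ∙ q`.
... | w , wc≡n! | q , qi≡n! = subst (_≤ 1ℚ)
  (sym (∑-reciprocals M (λ v → w v * q v) (λ v → c G v * i G v)
    (λ v → c*i-nonZero {G = G} {v}) λ v →
      trans (interchange ℕ.*-commutativeSemigroup (w v) (q v) (c G v) (i G v))
            (cong₂ _*_ (wc≡n! v) (qi≡n! v))))
  (/≤1 (w ∙ q) M (perfect⇒∙≤ G perfect w q wc≡n! qi≡n!))
  where
  M = n ! * n !
  instance
    M≢0 : NonZero M
    M≢0 = n ℕ.!* n !≢0
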